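{- Let $\phi(\bar v)$ be an atomic $L$-formula with $\bar v=\langle v_0,\dots,v_{n-1}\rangle$. Let $M\in\mathrm{pSh}(\Omega,L)$ and let $\bar a=\langle a_0,\dots,a_{n-1}\rangle$ be a tuple of sections of $M$. Then $[\phi(\bar a)]_M=[\phi^{\exists}(\bar a)]_M$.
   Context: **Presheaves.** Fix a complete Heyting algebra $\Omega$ (top $\top$). A presheaf $M$ over $\Omega$ is a set $|M|$ of sections with maps $E:|M|\to\Omega$ (extent) and $\upharpoonright:|M|\times\Omega\to|M|$ (restriction) such that $a\upharpoonright Ea=a$, $E(a\upharpoonright p)=Ea\wedge p$, $(a\upharpoonright p)\upharpoonright q=a\upharpoonright(p\wedge q)$. Put $[a=b]_M=\bigvee\{p\le Ea\wedge Eb: a\upharpoonright p=b\upharpoonright p\}$; presheaves are extensional: $Ea=Eb=[a=b]_M$ implies $a=b$. For a tuple $\bar a$ of sections, $E\bar a=\bigwedge_iEa_i$ ($E\emptyset=\top$), $\bar a\upharpoonright p=\langle a_i\upharpoonright p\rangle_i$, $[\bar a=\bar b]_M=\bigwedge_i[a_i=b_i]_M$. **Structures.** A signature has finitary relation symbols, finitary function symbols and a presheaf over $\Omega$ of constant symbols (so each constant $c$ has an extent $Ec$). An element $M$ of $\mathrm{pSh}(\Omega,L)$ is a presheaf with: for each $n$-ary $R$ a map $R^M:|M|^n\to\Omega$ with $R^M(\bar a)\le E\bar a$ and $[\bar a=\bar b]_M\wedge R^M(\bar a)\le R^M(\bar b)$; for each $n$-ary $f$ a map $f^M:|M|^n\to|M|$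 with $Ef^M(\bar a)=E\bar a$ and $[\bar a=\bar b]_M\le[f^M(\bar a)=f^M(\bar b)]_M$; for each constant $c$ a section $\mathfrak c^M$ with $E\mathfrak c^M=Ec$, compatibly with restriction. **Interpretation.** Terms are built from variables, constants and function symbols; atomic formulae are $t_0=t_1$ and $R(t_0,\dots,t_{m-1})$. For a term or formula $\chi$, $E\chi=\bigwedge\{Ec:c\text{ occurs in }\chi\}$. For $E\bar a\le Et$: $v_i^M(\bar a)=a_i$, $c^M(\bar a)=\mathfrak c^M\upharpoonright E\bar a$, $f(t_0,\dots)^M(\bar a)=f^M(t_0^M(\bar a),\dots)$. For atomic $\phi$, with $p=E\phi$: $[(t=s)(\bar a)]_M=E(\bar a\upharpoonright p)\wedge[t^M(\bar a\upharpoonright p)=s^M(\bar a\upharpoonright p)]_M$, and $[R(t_0,\dots)(\bar a)]_M=E(\bar a\upharpoonright p)\wedge R^M(t_0^M(\bar a\upharpoonright p),\dots)$. Further $[(\psi\wedge\chi)(\bar a)]_M=E\bar a\wedge E(\psi\wedge\chi)\wedge[\psi(\bar a)]_M\wedge[\chi(\bar a)]_M$ and $[\exists x\,\psi(\bar a)]_M=E\bar a\wedge E\psi\wedge\bigvee_{s\in|M|}[\psi(s,\bar a)]_M$. **Unnesting.** An atomic formula is unnested if it is of the form $v_i=v_j$, $v_i=c$, $R(v_{i_0},\dots,v_{i_{n-1}})$ or $v_{i_n}=f(v_{i_0},\dots,v_{i_{n-1}})$, with $c$ a constant symbol (equations between a variable and a constant, or between a variable and $f$ applied to variables, count as unnested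 in either order). For atomic $\phi$ define $\phi^\exists$ recursively: $\phi^\exists=\phi$ for $\phi$ unnested. If $\phi$ is $c=d$ with $c,d$ constants, $\phi^\exists$ is $\exists v_0\,(v_0=c\wedge v_0=d)$. If $\phi$ is $f(t_0,\dots,t_{m-1})=t_m$ with not all $t_i$ variables, let $S$ be the set of $i\le m$ with $t_i$ not a variable; choose distinct new variables $x_i$ ($i\in S$) not occurring in any $t_k$, and put $x_i=t_i$ for $i\notin S$; $\phi^\exists$ is the formula obtained by prefixing $\exists x_i$, one for each $i\in S$, to the conjunction of the formulae $(x_i=t_i)^\exists$ ($i\in S$) and $f(x_0,\dots,x_{m-1})=x_m$. If $\phi$ is $t_m=f(t_0,\dots,t_{m-1})$ do the same with last conjunct $x_m=f(x_0,\dots,x_{m-1})$. If $\phi$ is $R(t_0,\dots,t_{m-1})$ with not all $t_i$ variables, do the same with $S\subseteq\{0,\dots,m-1\}$ and last conjunct $R(x_0,\dots,x_{m-1})$. -}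

module Defs where

open import Level using (Level) renaming (suc to lsuc)
open import Data.Nat.Base using (ℕ; zero; suc; _+_)
open import Data.Fin.Base using (Fin; zero; suc; _↑ˡ_; _↑ʳ_)
open import Data.List.Base as List using (List)
open import Data.List.Membership.Propositional.Properties using (∈-filter⁺; ∈-allFin)
open import Data.List.Relation.Unary.Any using (index)
open import Data.Product.Base using (Σ; ∃; _×_; _,_; proj₁)
open import Data.Vec.Functional as Vector using (Vector; _∷_)
open import Function.Base using (_∘_; id)
open import Relation.Binary.Bundles using (Setoid)
open import Relation.Binary.Lattice.Bundles using (HeytingAlgebra)
open import Relation.Binary.PropositionalEquality.Core using (_≡_; refl)
open import Relation.Nullary using (Dec; yes; no; ¬_; ¬?)

-- "Set" in the mathematics is Set ℓ for one fixed ℓ.  Joins are taken of families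
-- indexed by arbitrary types in Set ℓ, so in particular of all subsets of Ω and of
-- all families indexed by the sections of a presheaf.
record CompleteHeytingAlgebra (ℓ : Level) : Set (lsuc ℓ) where
  field
    heytingAlgebra : HeytingAlgebra ℓ ℓ ℓ
  open HeytingAlgebra heytingAlgebra public
  field
    ⋁       : {I : Set ℓ} → (I → Carrier) → Carrier
    ⋁-upper : {I : Set ℓ} (f : I → Carrier) (i : I) → f i ≤ ⋁ f
    ⋁-least : {I : Set ℓ} (f : I → Carrier) (p : Carrier) → (∀ i → f i ≤ p) → ⋁ f ≤ p

  ⋀ : ∀ {n} → Vector Carrier n → Carrier
  ⋀ = Vector.foldr _∧_ ⊤

module _ {ℓ : Level} (Ω : CompleteHeytingAlgebra ℓ) where
  open CompleteHeytingAlgebra Ω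

  record Presheaf : Set (lsuc ℓ) where
    infixl 8 _↾_ _↾*_
    field
      sections : Setoid ℓ ℓ
    open Setoid sections public using () renaming (Carrier to Section; _≈_ to infix 4 _≈ˢ_)
    field
      E      : Section → Carrier
      _↾_    : Section → Carrier → Section
      E-cong : ∀ {a b} → a ≈ˢ b → E a ≈ E b
      ↾-cong : ∀ {a b p q} → a ≈ˢ b → p ≈ q → a ↾ p ≈ˢ b ↾ q
      ↾-E    : ∀ a → a ↾ E a ≈ˢ a
      E-↾    : ∀ a p → E (a ↾ p) ≈ E a ∧ p
      ↾-↾    : ∀ a p q → (a ↾ p) ↾ q ≈ˢ a ↾ (p ∧ q)

    [_≐_] : Section → Section → Carrier
    [ a ≐ b ] = ⋁ {I = Σ Carrier λ p → p ≤ E a ∧ E b × a ↾ p ≈ˢ b ↾ p} proj₁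

    field
      extensional : ∀ {a b} → E a ≈ E b → E a ≈ [ a ≐ b ] → a ≈ˢ b

    E* : ∀ {n} → Vector Section n → Carrier
    E* ā = ⋀ λ i → E (ā i)

    _↾*_ : ∀ {n} → Vector Section n → Carrier → Vector Section n
    (ā ↾* p) i = ā i ↾ p

    [_≐*_] : ∀ {n} → Vector Section n → Vector Section n → Carrier
    [ ā ≐* b̄ ] = ⋀ λ i → [ ā i ≐ b̄ i ]

  record Signature : Set (lsuc ℓ) where
    field
      Rel       : ℕ → Set ℓ
      Fun       : ℕ → Set ℓ
      constants : Presheaf

    open Presheaf constants public using ()
      renaming (Section to Const; _≈ˢ_ to _≈ᶜ_; E to Eᶜ; _↾_ to _↾ᶜ_)

-- Congruence of the relations and functions with respect to ≈ˢ is not a field: it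
-- follows from the compatibility with [ _≐*_ ] and extensionality.
record Structure {ℓ : Level} {Ω : CompleteHeytingAlgebra ℓ} (L : Signature Ω) : Set (lsuc ℓ) where
  open CompleteHeytingAlgebra Ω
  open Signature L
  field
    presheaf : Presheaf Ω
  open Presheaf presheaf public
  field
    relᴹ      : ∀ {n} → Rel n → Vector Section n → Carrier
    relᴹ-≤E   : ∀ {n} (R : Rel n) ā → relᴹ R ā ≤ E* ā
    relᴹ-resp : ∀ {n} (R : Rel n) ā b̄ → [ ā ≐* b̄ ] ∧ relᴹ R ā ≤ relᴹ R b̄

    funᴹ      : ∀ {n} → Fun n → Vector Section n → Section
    funᴹ-E    : ∀ {n} (f : Fun n) ā → E (funᴹ f ā) ≈ E* ā
    funᴹ-resp : ∀ {n} (f : Fun n) ā b̄ → [ ā ≐* b̄ ] ≤ [ funᴹ f ā ≐ funᴹ f b̄ ]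

    constᴹ      : Const → Section
    constᴹ-cong : ∀ {c d} → c ≈ᶜ d → constᴹ c ≈ˢ constᴹ d
    constᴹ-E    : ∀ c → E (constᴹ c) ≈ Eᶜ c
    constᴹ-↾    : ∀ c p → constᴹ (c ↾ᶜ p) ≈ˢ constᴹ c ↾ p

-- Terms and formulae are well scoped: a formula φ(v₀,…,vₙ₋₁) lives in Formula n,
-- and in ∃′ ψ the bound variable is v₀ of ψ while vᵢ outside is vᵢ₊₁ in ψ.  Only
-- the connectives ∧ and ∃ are needed for unnesting.
module _ {ℓ : Level} {Ω : CompleteHeytingAlgebra ℓ} (L : Signature Ω) where
  open Signature L

  data Term (n : ℕ) : Set ℓ where
    var   : Fin n → Term n
    const : Const → Term n
    fun   : ∀ {m} → Fun m → Vector (Term n) m → Term n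

  infix 6 _≐_
  data Atomic (n : ℕ) : Set ℓ where
    _≐_ : Term n → Term n → Atomic n
    rel : ∀ {m} → Rel m → Vector (Term n) m → Atomic n

  infixr 5 _∧′_
  data Formula (n : ℕ) : Set ℓ where
    atom : Atomic n → Formula n
    _∧′_ : Formula n → Formula n → Formula n
    ∃′_  : Formula (suc n) → Formula n

module _ {ℓ : Level} {Ω : CompleteHeytingAlgebra ℓ} {L : Signature Ω} where
  open CompleteHeytingAlgebra Ω using (Carrier; _∧_; ⊤; ⋁)
  open Signature L

  constsᵗ : ∀ {n} → Term L n → List Const
  constsᵗ (var i)    = List.[]
  constsᵗ (const c)  = List.[ c ]
  constsᵗ (fun f ts) = List.concat (List.tabulate λ i → constsᵗ (ts i))

  constsᵃ : ∀ {n} → Atomic L n → List Const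
  constsᵃ (t ≐ s)    = constsᵗ t List.++ constsᵗ s
  constsᵃ (rel R ts) = List.concat (List.tabulate λ i → constsᵗ (ts i))

  constsᶠ : ∀ {n} → Formula L n → List Const
  constsᶠ (atom φ) = constsᵃ φ
  constsᶠ (ψ ∧′ χ) = constsᶠ ψ List.++ constsᶠ χ
  constsᶠ (∃′ ψ)   = constsᶠ ψ

  extent : List Const → Carrier
  extent cs = List.foldr _∧_ ⊤ (List.map Eᶜ cs)

  module _ (M : Structure L) where
    open Structure M

    -- The defining equations make sense without the side condition E ā ≤ E t, which
    -- is therefore dropped; evalᵃ evaluates terms only at ā ↾ E φ, where the
    -- condition holds except possibly for the empty tuple (whose extent is ⊤).
    evalᵗ : ∀ {n} → Term L n → Vector Section n → Section
    evalᵗ (var i)    ā = ā i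
    evalᵗ (const c)  ā = constᴹ c ↾ E* ā
    evalᵗ (fun f ts) ā = funᴹ f λ i → evalᵗ (ts i) ā

    evalᵃ : ∀ {n} → Atomic L n → Vector Section n → Carrier
    evalᵃ φ@(t ≐ s)    ā = E* b̄ ∧ [ evalᵗ t b̄ ≐ evalᵗ s b̄ ]
      where b̄ = ā ↾* extent (constsᵃ φ)
    evalᵃ φ@(rel R ts) ā = E* b̄ ∧ relᴹ R (λ i → evalᵗ (ts i) b̄)
      where b̄ = ā ↾* extent (constsᵃ φ)

    evalᶠ : ∀ {n} → Formula L n → Vector Section n → Carrier
    evalᶠ (atom φ) ā = evalᵃ φ ā
    evalᶠ (ψ ∧′ χ) ā = E* ā ∧ extent (constsᶠ (ψ ∧′ χ)) ∧ evalᶠ ψ ā ∧ evalᶠ χ ā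
    evalᶠ (∃′ ψ)   ā = E* ā ∧ extent (constsᶠ ψ) ∧ ⋁ λ (s : Section) → evalᶠ ψ (s ∷ ā)

  ⟦_⟧[_] : ∀ {n} → Formula L n → (M : Structure L) → Vector (Structure.Section M) n → Carrier
  ⟦ φ ⟧[ M ] = evalᶠ M φ

  IsVar : ∀ {n} → Term L n → Set ℓ
  IsVar t = ∃ λ i → t ≡ var i

  isVar? : ∀ {n} (t : Term L n) → Dec (IsVar t)
  isVar? (var i)    = yes (i , refl)
  isVar? (const c)  = no λ { (_ , ()) }
  isVar? (fun f ts) = no λ { (_ , ()) }

  -- The data of one unnesting step for t₀,…,tₘ₋₁.  The terms are in n
  -- variables, read in k variables along ρ; the s = |S| new variables come first, so
  -- the conjuncts live in s + k variables, the old ones being shifted by s.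
  module Step {m n k : ℕ} (ρ : Fin n → Fin k) (ts : Vector (Term L n) m) where

    nonVar? : (i : Fin m) → Dec (¬ IsVar (ts i))
    nonVar? i = ¬? (isVar? (ts i))

    S : List (Fin m)
    S = List.filter nonVar? (List.allFin m)

    s : ℕ
    s = List.length S

    old : Fin n → Fin (s + k)
    old = (s ↑ʳ_) ∘ ρ

    -- xᵢ is the new variable numbered by the position of i in S if i ∈ S, and tᵢ
    -- itself otherwise.
    x : Fin m → Fin (s + k)
    x i with isVar? (ts i)
    ... | yes (j , _) = old j
    ... | no  ¬v      = index (∈-filter⁺ nonVar? (∈-allFin i) ¬v) ↑ˡ k

    ∃* : ∀ r → Formula L (r + k) → Formula L k
    ∃* zero    ψ = ψ
    ∃* (suc r) ψ = ∃* r (∃′ ψ)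

    -- For S = ∅ this is `last` alone, without quantifiers, so that the clauses below
    -- return unnested formulae unchanged.
    close : (Fin m → Formula L (s + k)) → Formula L (s + k) → Formula L k
    close conjunct last = ∃* s (List.foldr _∧′_ last (List.map conjunct S))

  -- unnestVar ρ j t is (vⱼ = t[ρ])^∃, where t[ρ] renames every vᵢ in t to v_{ρ i}.
  -- Carrying ρ instead of renaming t keeps the recursion structural in t.
  unnestVar : ∀ {n k} → (Fin n → Fin k) → Fin k → Term L n → Formula L k
  unnestVar ρ j (var i)    = atom (var j ≐ var (ρ i))
  unnestVar ρ j (const c)  = atom (var j ≐ const c)
  unnestVar ρ j (fun f ts) =
    close (λ i → unnestVar old (x i) (ts i)) (atom (var (s ↑ʳ j) ≐ fun f (var ∘ x)))
    where open Step ρ ts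

  -- In an equation with f(t₀,…,tₘ₋₁) on one side, the term on the other side is put
  -- in front of t₀,…,tₘ₋₁.  f(…) = g(…) falls under the clause for f(…) = t.
  infix 7 _^∃
  _^∃ : ∀ {n} → Atomic L n → Formula L n
  (var i ≐ t) ^∃           = unnestVar id i t
  (const c ≐ var j) ^∃     = atom (const c ≐ var j)
  (const c ≐ const d) ^∃   = ∃′ (atom (var zero ≐ const c) ∧′ atom (var zero ≐ const d))
  (const c ≐ fun f ts) ^∃  =
    close (λ i → unnestVar old (x i) (us i)) (atom (var (x zero) ≐ fun f (var ∘ x ∘ suc)))
    where us = const c ∷ ts
          open Step id us
  (fun f ts ≐ t) ^∃        =
    close (λ i → unnestVar old (x i) (us i)) (atom (fun f (var ∘ x ∘ suc) ≐ var (x zero)))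
    where us = t ∷ ts
          open Step id us
  rel R ts ^∃              =
    close (λ i → unnestVar old (x i) (ts i)) (atom (rel R (var ∘ x)))
    where open Step id ts

{-# OPTIONS --safe #-}

-- Semantic equality of sections is strict: [ a ≐ b ] lies below the extents of a and
-- b.  Hence the extents occurring in the definition of evalᶠ are implied by the truth
-- values of atomic formulae: an atomic formula at ā is E* ā ∧ [ t(ā) ≐ s(ā) ], a
-- conjunction is a plain meet and an existential a plain join.  One unnesting step is
-- then the identity ⋁ x̄ ([ x̄ ≐* t̄(ā) ] ∧ Q x̄) = Q (t̄(ā)) for Q strict and
-- compatible with [ _≐*_ ], where the join is attained at x̄ = t̄(ā).
module Submission where

open import Defs
open import Level using (Level)
open import Data.Nat.Base using (ℕ; zero; suc; _+_)
open import Data.Fin.Base using (Fin; zero; suc; _↑ˡ_; _↑ʳ_)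
open import Data.List.Base as List using (List; []; _∷_; lookup)
open import Data.List.Membership.Propositional.Properties using (∈-filter⁺; ∈-allFin)
open import Data.List.Relation.Unary.Any.Properties using (lookup-index)
open import Data.Product.Base using (∃; _×_; _,_; proj₁; proj₂)
open import Data.Sum.Base using (_⊎_; inj₁; inj₂)
open import Data.Vec.Functional as Vector using (Vector)
open import Function.Base using (_∘_; id)
open import Relation.Binary.Bundles using (Setoid)
import Relation.Binary.Lattice.Properties.HeytingAlgebra as HeytingAlgebraProperties
import Relation.Binary.Lattice.Properties.MeetSemilattice as MeetSemilatticeProperties
open import Relation.Binary.PropositionalEquality.Core as ≡ using (_≡_; subst)
open import Relation.Nullary using (yes; no)

-- Finite meets and joins in a complete Heyting algebra.

module ⋀-Properties {ℓ : Level} (Ω : CompleteHeytingAlgebra ℓ) where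
  open CompleteHeytingAlgebra Ω
  open HeytingAlgebraProperties heytingAlgebra using (swap-transpose-⇨)

  ⋀-lower : ∀ {n} (f : Vector Carrier n) i → ⋀ f ≤ f i
  ⋀-lower f zero    = x∧y≤x _ _
  ⋀-lower f (suc i) = trans (x∧y≤y _ _) (⋀-lower (f ∘ suc) i)

  ⋀-greatest : ∀ {n} (f : Vector Carrier n) {q} → (∀ i → q ≤ f i) → q ≤ ⋀ f
  ⋀-greatest {zero}  f h = maximum _
  ⋀-greatest {suc n} f h = ∧-greatest (h zero) (⋀-greatest (f ∘ suc) (h ∘ suc))

  -- Distributivity of meets over joins: each factor in turn is moved across the implication, so
  -- that only one join has to be bounded at a time.
  ⋁-least₂ : {I J : Set ℓ} (f : I → Carrier) (g : J → Carrier) {p : Carrier} →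
             (∀ i j → f i ∧ g j ≤ p) → ⋁ f ∧ ⋁ g ≤ p
  ⋁-least₂ f g h = transpose-∧ (⋁-least f _ λ i →
    swap-transpose-⇨ (transpose-∧ (⋁-least g _ λ j → swap-transpose-⇨ (h i j))))

-- Semantic equality of sections.

module Equality {ℓ : Level} {Ω : CompleteHeytingAlgebra ℓ} (P : Presheaf Ω) where
  open CompleteHeytingAlgebra Ω
  open Presheaf P
  open ⋀-Properties Ω
  private
    module S = Setoid sections

  E-↾-≤ˡ : ∀ a p → E (a ↾ p) ≤ E a
  E-↾-≤ˡ a p = trans (reflexive (E-↾ a p)) (x∧y≤x _ _)

  E-↾-≤ʳ : ∀ a p → E (a ↾ p) ≤ p
  E-↾-≤ʳ a p = trans (reflexive (E-↾ a p)) (x∧y≤y _ _)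

  ≤-E-↾ : ∀ {a p q} → q ≤ E a → q ≤ p → q ≤ E (a ↾ p)
  ≤-E-↾ {a} {p} q≤Ea q≤p = trans (∧-greatest q≤Ea q≤p) (reflexive (Eq.sym (E-↾ a p)))

  ↾-absorb : ∀ {p q} a → q ≤ p → (a ↾ p) ↾ q S.≈ a ↾ q
  ↾-absorb a q≤p =
    S.trans (↾-↾ a _ _) (↾-cong S.refl (antisym (x∧y≤y _ _) (∧-greatest q≤p refl)))

  ≐-strictˡ : ∀ {a b} → [ a ≐ b ] ≤ E a
  ≐-strictˡ = ⋁-least _ _ λ { (p , p≤ , _) → trans p≤ (x∧y≤x _ _) }

  ≐-strictʳ : ∀ {a b} → [ a ≐ b ] ≤ E b
  ≐-strictʳ = ⋁-least _ _ λ { (p , p≤ , _) → trans p≤ (x∧y≤y _ _) }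

  ≐-intro : ∀ {a b q} → q ≤ E a → q ≤ E b → a ↾ q ≈ˢ b ↾ q → q ≤ [ a ≐ b ]
  ≐-intro q≤Ea q≤Eb eq = ⋁-upper proj₁ (_ , ∧-greatest q≤Ea q≤Eb , eq)

  ≐-refl : ∀ {a q} → q ≤ E a → q ≤ [ a ≐ a ]
  ≐-refl q≤ = ≐-intro q≤ q≤ S.refl

  ≐-reflexive : ∀ {a b q} → a ≡ b → q ≤ E a → q ≤ [ a ≐ b ]
  ≐-reflexive ≡.refl = ≐-refl

  ≐-sym : ∀ {a b} → [ a ≐ b ] ≤ [ b ≐ a ]
  ≐-sym = ⋁-least _ _ λ { (p , p≤ , eq) →
    ≐-intro (trans p≤ (x∧y≤y _ _)) (trans p≤ (x∧y≤x _ _)) (S.sym eq) }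

  -- Witnesses of the two equalities at `p` and `p′` compose after restriction to `p ∧ p′`;
  -- `⋁-least₂` reduces the meet of the two joins to this case.
  ≐-trans : ∀ {a b c q} → q ≤ [ a ≐ b ] → q ≤ [ b ≐ c ] → q ≤ [ a ≐ c ]
  ≐-trans {a} {b} {c} h k = trans (∧-greatest h k) (⋁-least₂ _ _ λ
    { (p , p≤ , eq) (p′ , p′≤ , eq′) → ≐-intro
      (trans (x∧y≤x _ _) (trans p≤ (x∧y≤x _ _)))
      (trans (x∧y≤y _ _) (trans p′≤ (x∧y≤y _ _)))
      (S.trans (restrict (x∧y≤x _ _) eq) (restrict (x∧y≤y _ _) eq′)) })
    where
    restrict : ∀ {a b p q} → q ≤ p → a ↾ p ≈ˢ b ↾ p → a ↾ q ≈ˢ b ↾ q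
    restrict q≤p eq = S.trans (S.sym (↾-absorb _ q≤p))
      (S.trans (↾-cong eq Eq.refl) (↾-absorb _ q≤p))

  ↾-≐ : ∀ {a p q} → q ≤ E a → q ≤ p → q ≤ [ a ↾ p ≐ a ]
  ↾-≐ q≤Ea q≤p = ≐-intro (≤-E-↾ q≤Ea q≤p) q≤Ea (↾-absorb _ q≤p)

  ↾-≐-↾ : ∀ {a p p′ q} → q ≤ E a → q ≤ p → q ≤ p′ → q ≤ [ a ↾ p ≐ a ↾ p′ ]
  ↾-≐-↾ q≤Ea q≤p q≤p′ = ≐-trans (↾-≐ q≤Ea q≤p) (trans (↾-≐ q≤Ea q≤p′) ≐-sym)

  E*-lower : ∀ {n} (ā : Vector Section n) i → E* ā ≤ E (ā i)
  E*-lower ā = ⋀-lower λ i → E (ā i)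

  E*-greatest : ∀ {n q} (ā : Vector Section n) → (∀ i → q ≤ E (ā i)) → q ≤ E* ā
  E*-greatest ā = ⋀-greatest λ i → E (ā i)

  ≐*-lower : ∀ {n} (ā b̄ : Vector Section n) i → [ ā ≐* b̄ ] ≤ [ ā i ≐ b̄ i ]
  ≐*-lower ā b̄ = ⋀-lower λ i → [ ā i ≐ b̄ i ]

  ≐*-greatest : ∀ {n q} (ā b̄ : Vector Section n) → (∀ i → q ≤ [ ā i ≐ b̄ i ]) → q ≤ [ ā ≐* b̄ ]
  ≐*-greatest ā b̄ = ⋀-greatest λ i → [ ā i ≐ b̄ i ]

-- Tuples extended by values of bound variables.

module Semantics {ℓ : Level} {Ω : CompleteHeytingAlgebra ℓ} {L : Signature Ω} (M : Structure L) where
  open CompleteHeytingAlgebra Ω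
  open Signature L using (Fun; Const)
  open Structure M
  open MeetSemilatticeProperties meetSemilattice using (∧-cong)
  open Equality presheaf

  -- Agrees with Vector._++_ only pointwise; by unfolding to iterated _∷_ it is
  -- definitionally the tuple at which the quantifiers of ∃* evaluate their body.
  extend : ∀ {r k} → Vector Section r → Vector Section k → Vector Section (r + k)
  extend {zero}  s̄ b̄ = b̄
  extend {suc r} s̄ b̄ = s̄ zero Vector.∷ extend (s̄ ∘ suc) b̄

  extend-↑ˡ : ∀ {r k} (s̄ : Vector Section r) (b̄ : Vector Section k) i →
              extend s̄ b̄ (i ↑ˡ k) ≡ s̄ i
  extend-↑ˡ s̄ b̄ zero    = ≡.refl
  extend-↑ˡ s̄ b̄ (suc i) = extend-↑ˡ (s̄ ∘ suc) b̄ i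

  extend-↑ʳ : ∀ {r k} (s̄ : Vector Section r) (b̄ : Vector Section k) j →
              extend s̄ b̄ (r ↑ʳ j) ≡ b̄ j
  extend-↑ʳ {zero}  s̄ b̄ j = ≡.refl
  extend-↑ʳ {suc r} s̄ b̄ j = extend-↑ʳ (s̄ ∘ suc) b̄ j

  E*-extend-≤ : ∀ {r k} (s̄ : Vector Section r) (b̄ : Vector Section k) →
                E* (extend s̄ b̄) ≤ E* b̄
  E*-extend-≤ {zero}  s̄ b̄ = refl
  E*-extend-≤ {suc r} s̄ b̄ = trans (x∧y≤y _ _) (E*-extend-≤ (s̄ ∘ suc) b̄)

  ≤-E*-extend : ∀ {r k q} (s̄ : Vector Section r) (b̄ : Vector Section k) →
                (∀ i → q ≤ E (s̄ i)) → q ≤ E* b̄ → q ≤ E* (extend s̄ b̄)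
  ≤-E*-extend {zero}  s̄ b̄ h q≤ = q≤
  ≤-E*-extend {suc r} s̄ b̄ h q≤ = ∧-greatest (h zero) (≤-E*-extend (s̄ ∘ suc) b̄ (h ∘ suc) q≤)

  -- Terms: extents, and compatibility with equality and restriction of tuples.

  ≤-extent-++ : ∀ {q} (cs : List Const) {ds : List Const} →
                q ≤ extent {L = L} cs → q ≤ extent {L = L} ds → q ≤ extent {L = L} (cs List.++ ds)
  ≤-extent-++ []       h k = k
  ≤-extent-++ (c ∷ cs) h k =
    ∧-greatest (trans h (x∧y≤x _ _)) (≤-extent-++ cs (trans h (x∧y≤y _ _)) k)

  ≤-extent-concat : ∀ {n q} (f : Fin n → List Const) → (∀ i → q ≤ extent {L = L} (f i)) →
                    q ≤ extent {L = L} (List.concat (List.tabulate f))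
  ≤-extent-concat {zero}  f h = maximum _
  ≤-extent-concat {suc n} f h = ≤-extent-++ (f zero) (h zero) (≤-extent-concat (f ∘ suc) (h ∘ suc))

  E-funᴹ-≤ : ∀ {m} (f : Fun m) c̄ i → E (funᴹ f c̄) ≤ E (c̄ i)
  E-funᴹ-≤ f c̄ i = trans (reflexive (funᴹ-E f c̄)) (E*-lower c̄ i)

  -- Function application has the extent of its arguments and a constant is only ever restricted
  -- further, so a value exists at most where all constants of the term do.
  E-evalᵗ-≤ : ∀ {n} (t : Term L n) ā → E (evalᵗ M t ā) ≤ extent {L = L} (constsᵗ t)
  E-evalᵗ-≤ (var i)    ā = maximum _
  E-evalᵗ-≤ (const c)  ā =
    ∧-greatest (trans (E-↾-≤ˡ _ _) (reflexive (constᴹ-E c))) (maximum _)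
  E-evalᵗ-≤ (fun f ts) ā =
    ≤-extent-concat _ λ i → trans (E-funᴹ-≤ f _ i) (E-evalᵗ-≤ (ts i) ā)

  -- The delicate case is a constant, whose value is `constᴹ c` restricted to the extent of the
  -- tuple. The two restrictions agree below both tuple extents and the extent of `constᴹ c`. The
  -- last bound comes from the extent of the whole term, which passes down to the arguments of a
  -- function.
  evalᵗ-resp : ∀ {n q} (t : Term L n) ā b̄ → q ≤ E* ā → q ≤ E* b̄ → q ≤ [ ā ≐* b̄ ] →
               q ≤ E (evalᵗ M t ā) → q ≤ [ evalᵗ M t ā ≐ evalᵗ M t b̄ ]
  evalᵗ-resp (var i)    ā b̄ q≤Eā q≤Eb̄ ā≐b̄ q≤Et = trans ā≐b̄ (≐*-lower ā b̄ i)
  evalᵗ-resp (const c)  ā b̄ q≤Eā q≤Eb̄ ā≐b̄ q≤Et = ↾-≐-↾ (trans q≤Et (E-↾-≤ˡ _ _)) q≤Eā q≤Eb̄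
  evalᵗ-resp (fun f ts) ā b̄ q≤Eā q≤Eb̄ ā≐b̄ q≤Et =
    trans (≐*-greatest _ _ λ i →
            evalᵗ-resp (ts i) ā b̄ q≤Eā q≤Eb̄ ā≐b̄ (trans q≤Et (E-funᴹ-≤ f _ i)))
          (funᴹ-resp f _ _)

  E*-↾*-≤ : ∀ {n} (ā : Vector Section n) p → E* (ā ↾* p) ≤ E* ā
  E*-↾*-≤ ā p = E*-greatest ā λ i → trans (E*-lower (ā ↾* p) i) (E-↾-≤ˡ _ _)

  ≤-E*-↾* : ∀ {n p q} (ā : Vector Section n) → q ≤ E* ā → q ≤ p → q ≤ E* (ā ↾* p)
  ≤-E*-↾* {p = p} ā q≤Eā q≤p =
    E*-greatest (ā ↾* p) λ i → ≤-E-↾ (trans q≤Eā (E*-lower ā i)) q≤p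

  ↾*-≐* : ∀ {n p q} (ā : Vector Section n) → q ≤ E* (ā ↾* p) → q ≤ [ ā ↾* p ≐* ā ]
  ↾*-≐* {p = p} ā q≤E = ≐*-greatest (ā ↾* p) ā λ i →
    ↾-≐ (trans q≤E (trans (E*-lower (ā ↾* p) i) (E-↾-≤ˡ _ _)))
        (trans q≤E (trans (E*-lower (ā ↾* p) i) (E-↾-≤ʳ _ _)))

  ≐*-↾* : ∀ {n p q} (ā : Vector Section n) → q ≤ E* (ā ↾* p) → q ≤ [ ā ≐* ā ↾* p ]
  ≐*-↾* {p = p} ā q≤E = ≐*-greatest ā (ā ↾* p) λ i →
    trans (↾*-≐* ā q≤E) (trans (≐*-lower (ā ↾* p) ā i) ≐-sym)

  evalᵗ-↾* : ∀ {n p q} (t : Term L n) (ā : Vector Section n) → q ≤ E* (ā ↾* p) →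
             q ≤ E (evalᵗ M t (ā ↾* p)) → q ≤ [ evalᵗ M t (ā ↾* p) ≐ evalᵗ M t ā ]
  evalᵗ-↾* t ā q≤E = evalᵗ-resp t _ _ q≤E (trans q≤E (E*-↾*-≤ ā _)) (↾*-≐* ā q≤E)

  ↾*-evalᵗ : ∀ {n p q} (t : Term L n) (ā : Vector Section n) → q ≤ E* (ā ↾* p) →
             q ≤ E (evalᵗ M t ā) → q ≤ [ evalᵗ M t ā ≐ evalᵗ M t (ā ↾* p) ]
  ↾*-evalᵗ t ā q≤E = evalᵗ-resp t _ _ (trans q≤E (E*-↾*-≤ ā _)) q≤E (≐*-↾* ā q≤E)

  -- Atomic formulae freed of the restriction to their extent.

  ⟦_⟧ᵃ : ∀ {n} → Atomic L n → Vector Section n → Carrier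
  ⟦ t ≐ s ⟧ᵃ    ā = [ evalᵗ M t ā ≐ evalᵗ M s ā ]
  ⟦ rel R ts ⟧ᵃ ā = relᴹ R λ i → evalᵗ M (ts i) ā

  ⟦_⟧ᵃ-extent : ∀ {n} (φ : Atomic L n) ā → ⟦ φ ⟧ᵃ ā ≤ extent {L = L} (constsᵃ φ)
  ⟦ t ≐ s ⟧ᵃ-extent    ā = ≤-extent-++ (constsᵗ t)
    (trans ≐-strictˡ (E-evalᵗ-≤ t ā)) (trans ≐-strictʳ (E-evalᵗ-≤ s ā))
  ⟦ rel R ts ⟧ᵃ-extent ā = ≤-extent-concat _ λ i →
    trans (relᴹ-≤E R _) (trans (E*-lower _ i) (E-evalᵗ-≤ (ts i) ā))

  -- Below the extent of the restricted tuple, that tuple and `ā` are equal, so the values of the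
  -- terms at one may be exchanged for those at the other wherever they exist. The two inequalities
  -- are the two directions of this exchange.
  evalᵃ-≈ : ∀ {n} (φ : Atomic L n) ā → evalᵃ M φ ā ≈ E* ā ∧ ⟦ φ ⟧ᵃ ā
  evalᵃ-≈ φ@(t ≐ s) ā = antisym
    (∧-greatest (trans (x∧y≤x _ _) (E*-↾*-≤ ā _))
      (≐-trans (trans (evalᵗ-↾* t ā (x∧y≤x _ _) (trans (x∧y≤y _ _) ≐-strictˡ)) ≐-sym)
      (≐-trans (x∧y≤y _ _)
               (evalᵗ-↾* s ā (x∧y≤x _ _) (trans (x∧y≤y _ _) ≐-strictʳ)))))
    (∧-greatest q≤E
      (≐-trans (trans (↾*-evalᵗ t ā q≤E (trans (x∧y≤y _ _) ≐-strictˡ)) ≐-sym)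
      (≐-trans (x∧y≤y _ _)
               (↾*-evalᵗ s ā q≤E (trans (x∧y≤y _ _) ≐-strictʳ)))))
    -- Restricting `ā` loses nothing here, since strictness already puts the truth value below the
    -- extents of the constants.
    where q≤E = ≤-E*-↾* ā (x∧y≤x _ _) (trans (x∧y≤y _ _) (⟦ φ ⟧ᵃ-extent ā))
  evalᵃ-≈ φ@(rel R ts) ā = antisym
    (∧-greatest (trans (x∧y≤x _ _) (E*-↾*-≤ ā _))
      (trans (∧-greatest (≐*-greatest _ _ λ i →
               evalᵗ-↾* (ts i) ā (x∧y≤x _ _)
                 (trans (x∧y≤y _ _) (trans (relᴹ-≤E R _) (E*-lower _ i))))
               (x∧y≤y _ _))
             (relᴹ-resp R _ _)))
    (∧-greatest q≤E
      (trans (∧-greatest (≐*-greatest _ _ λ i →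
               ↾*-evalᵗ (ts i) ā q≤E
                 (trans (x∧y≤y _ _) (trans (relᴹ-≤E R _) (E*-lower _ i))))
               (x∧y≤y _ _))
             (relᴹ-resp R _ _)))
    where q≤E = ≤-E*-↾* ā (x∧y≤x _ _) (trans (x∧y≤y _ _) (⟦ φ ⟧ᵃ-extent ā))

  -- Conjunctions and existentials as plain meets and joins.

  evalᶠ-≤-E* : ∀ {n} (ψ : Formula L n) ā → evalᶠ M ψ ā ≤ E* ā
  evalᶠ-≤-E* (atom φ) ā = trans (reflexive (evalᵃ-≈ φ ā)) (x∧y≤x _ _)
  evalᶠ-≤-E* (ψ ∧′ χ) ā = x∧y≤x _ _
  evalᶠ-≤-E* (∃′ ψ)   ā = x∧y≤x _ _

  evalᶠ-≤-extent : ∀ {n} (ψ : Formula L n) ā → evalᶠ M ψ ā ≤ extent {L = L} (constsᶠ ψ)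
  evalᶠ-≤-extent (atom φ) ā =
    trans (reflexive (evalᵃ-≈ φ ā)) (trans (x∧y≤y _ _) (⟦ φ ⟧ᵃ-extent ā))
  evalᶠ-≤-extent (ψ ∧′ χ) ā = trans (x∧y≤y _ _) (x∧y≤x _ _)
  evalᶠ-≤-extent (∃′ ψ)   ā = trans (x∧y≤y _ _) (x∧y≤x _ _)

  evalᶠ-∧ : ∀ {n} (ψ χ : Formula L n) ā → evalᶠ M (ψ ∧′ χ) ā ≈ evalᶠ M ψ ā ∧ evalᶠ M χ ā
  evalᶠ-∧ ψ χ ā = antisym (trans (x∧y≤y _ _) (x∧y≤y _ _))
    (∧-greatest (trans (x∧y≤x _ _) (evalᶠ-≤-E* ψ ā))
    (∧-greatest (≤-extent-++ (constsᶠ ψ) (trans (x∧y≤x _ _) (evalᶠ-≤-extent ψ ā))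
                                         (trans (x∧y≤y _ _) (evalᶠ-≤-extent χ ā)))
                refl))

  evalᶠ-∃ : ∀ {n} (ψ : Formula L (suc n)) ā →
            evalᶠ M (∃′ ψ) ā ≈ ⋁ λ s → evalᶠ M ψ (s Vector.∷ ā)
  evalᶠ-∃ ψ ā = antisym (trans (x∧y≤y _ _) (x∧y≤y _ _))
    (∧-greatest (⋁-least _ _ λ s → trans (evalᶠ-≤-E* ψ _) (x∧y≤y _ _))
    (∧-greatest (⋁-least _ _ λ s → evalᶠ-≤-extent ψ _)
                refl))

  -- Conjuncts are addressed by their position in the list, matching the numbering of the new
  -- variables by positions in `S`.
  evalᶠ-⋀-lower : ∀ {I : Set} {n} (χ : I → Formula L n) (is : List I) last ā →
    let eval = evalᶠ M (List.foldr _∧′_ last (List.map χ is)) ā in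
    eval ≤ evalᶠ M last ā × (∀ l → eval ≤ evalᶠ M (χ (lookup is l)) ā)
  evalᶠ-⋀-lower χ []       last ā = refl , λ ()
  evalᶠ-⋀-lower χ (i ∷ is) last ā
    with evalᶠ-⋀-lower χ is last ā | evalᶠ-∧ (χ i) (List.foldr _∧′_ last (List.map χ is)) ā
  ... | h , hs | eq = trans tail h , λ
    { zero    → trans (reflexive eq) (x∧y≤x _ _)
    ; (suc l) → trans tail (hs l) }
    where tail = trans (reflexive eq) (x∧y≤y _ _)

  evalᶠ-⋀-greatest : ∀ {I : Set} {n q} (χ : I → Formula L n) (is : List I) last ā →
    q ≤ evalᶠ M last ā → (∀ i → q ≤ evalᶠ M (χ i) ā) →
    q ≤ evalᶠ M (List.foldr _∧′_ last (List.map χ is)) ā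
  evalᶠ-⋀-greatest χ []       last ā h hs = h
  evalᶠ-⋀-greatest χ (i ∷ is) last ā h hs =
    trans (∧-greatest (hs i) (evalᶠ-⋀-greatest χ is last ā h hs))
          (reflexive (Eq.sym (evalᶠ-∧ (χ i) (List.foldr _∧′_ last (List.map χ is)) ā)))

  -- One unnesting step.

  module StepSemantics {m n k : ℕ} (ρ : Fin n → Fin k) (ts : Vector (Term L n) m) where
    open Step ρ ts

    -- Turns the `with` inside `x` into equations. In the second case `i` is recovered as the entry
    -- of `S` at `l`, so matching on that equation replaces `i` by `lookup S l`.
    x-cases : ∀ i → (∃ λ j → ts i ≡ var j × x i ≡ old j) ⊎
                    (∃ λ l → lookup S l ≡ i × x i ≡ l ↑ˡ k)
    x-cases i with isVar? (ts i)
    ... | yes (j , eq) = inj₁ (j , eq , ≡.refl)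
    ... | no ¬v        = inj₂ (_ , ≡.sym (lookup-index i∈S) , ≡.refl)
      where i∈S = ∈-filter⁺ nonVar? (∈-allFin i) ¬v

    ∃*-upper : ∀ r (ψ : Formula L (r + k)) (s̄ : Vector Section r) b̄ →
               evalᶠ M ψ (extend s̄ b̄) ≤ evalᶠ M (∃* r ψ) b̄
    ∃*-upper zero    ψ s̄ b̄ = refl
    ∃*-upper (suc r) ψ s̄ b̄ =
      -- The innermost quantifier binds variable `zero` and so receives `s̄ zero`; the tail of `s̄`
      -- serves the outer quantifiers.
      trans (⋁-upper (λ s → evalᶠ M ψ (s Vector.∷ extend (s̄ ∘ suc) b̄)) (s̄ zero))
      (trans (reflexive (Eq.sym (evalᶠ-∃ ψ _))) (∃*-upper r (∃′ ψ) (s̄ ∘ suc) b̄))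

    ∃*-least : ∀ r (ψ : Formula L (r + k)) b̄ {p} →
               (∀ s̄ → evalᶠ M ψ (extend {r} s̄ b̄) ≤ p) → evalᶠ M (∃* r ψ) b̄ ≤ p
    ∃*-least zero    ψ b̄ h = h λ ()
    ∃*-least (suc r) ψ b̄ h = ∃*-least r (∃′ ψ) b̄ λ s̄ →
      trans (reflexive (evalᶠ-∃ ψ _)) (⋁-least _ _ λ s → h (s Vector.∷ s̄))

    -- `Q` abstracts the last conjunct as a function of the values of the `xᵢ`, which covers
    -- equations and relations alike. The assumption on the conjuncts ranges over all tuples
    -- agreeing with `ā` on the old variables, so that an induction hypothesis can be supplied for
    -- it.
    close-≈ : (conjunct : Fin m → Formula L (s + k)) (last : Formula L (s + k))
      (ā : Vector Section n) (b̄ : Vector Section k) → (∀ i → b̄ (ρ i) ≡ ā i) →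
      (Q : Vector Section m → Carrier) →
      (∀ c̄ → Q c̄ ≤ E* c̄) → (∀ c̄ d̄ → [ c̄ ≐* d̄ ] ∧ Q c̄ ≤ Q d̄) →
      (∀ i b̄′ → (∀ j → b̄′ (old j) ≡ ā j) →
         evalᶠ M (conjunct i) b̄′ ≈ E* b̄′ ∧ [ b̄′ (x i) ≐ evalᵗ M (ts i) ā ]) →
      (∀ b̄′ → (∀ j → b̄′ (s ↑ʳ j) ≡ b̄ j) → evalᶠ M last b̄′ ≈ E* b̄′ ∧ Q (b̄′ ∘ x)) →
      evalᶠ M (close conjunct last) b̄ ≈ E* b̄ ∧ Q (λ i → evalᵗ M (ts i) ā)
    close-≈ conjunct last ā b̄ b̄ρ≡ā Q Q-strict Q-resp conjunct-≈ last-≈ =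
      antisym (∃*-least s body b̄ below) above
      where
      body = List.foldr _∧′_ last (List.map conjunct S)
      t̄ = λ i → evalᵗ M (ts i) ā

      old≡ : ∀ (s̄ : Vector Section s) j → extend s̄ b̄ (old j) ≡ ā j
      old≡ s̄ j = ≡.trans (extend-↑ʳ s̄ b̄ (ρ j)) (b̄ρ≡ā j)

      below : ∀ s̄ → evalᶠ M body (extend s̄ b̄) ≤ E* b̄ ∧ Q t̄
      below s̄ = ∧-greatest (trans q≤E (E*-extend-≤ s̄ b̄))
        (trans (∧-greatest (≐*-greatest _ _ x≐t) (trans (proj₁ bounds)
                 (trans (reflexive (last-≈ b̄′ (extend-↑ʳ s̄ b̄))) (x∧y≤y _ _))))
               (Q-resp _ _))
        where
        b̄′ = extend s̄ b̄
        bounds = evalᶠ-⋀-lower conjunct S last b̄′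
        q≤E = evalᶠ-≤-E* body b̄′
        x≐t : ∀ i → evalᶠ M body b̄′ ≤ [ b̄′ (x i) ≐ t̄ i ]
        -- Outside `S` there is no conjunct, but there `xᵢ` is the variable `tᵢ` itself; inside `S`
        -- the conjunct states the equality.
        x≐t i with x-cases i
        ... | inj₁ (j , t≡ , x≡) = ≐-reflexive
          (≡.trans (≡.cong b̄′ x≡)
            (≡.trans (old≡ s̄ j) (≡.sym (≡.cong (λ t → evalᵗ M t ā) t≡))))
          (trans q≤E (E*-lower b̄′ (x i)))
        ... | inj₂ (l , ≡.refl , _) = trans (proj₂ bounds l)
          (trans (reflexive (conjunct-≈ _ b̄′ (old≡ s̄))) (x∧y≤y _ _))

      above : E* b̄ ∧ Q t̄ ≤ evalᶠ M (∃* s body) b̄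
      above = trans
        (evalᶠ-⋀-greatest conjunct S last b̄′
          (trans (∧-greatest q≤E (trans (∧-greatest (≐*-greatest _ _ t≐x) (x∧y≤y _ _)) (Q-resp _ _)))
                 (reflexive (Eq.sym (last-≈ b̄′ (extend-↑ʳ s̄ b̄)))))
          (λ i → trans (∧-greatest q≤E (trans (t≐x i) ≐-sym))
                       (reflexive (Eq.sym (conjunct-≈ i b̄′ (old≡ s̄))))))
        (∃*-upper s body s̄ b̄)
        where
        -- Each new variable takes the value of the term it replaces.
        s̄ = λ l → t̄ (lookup S l)
        b̄′ = extend s̄ b̄
        -- Strictness of `Q` makes all values `t̄ i` exist, which bounds the extent of the extended
        -- tuple and licenses reflexivity at each `t̄ i`.
        q≤Et : ∀ i → E* b̄ ∧ Q t̄ ≤ E (t̄ i)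
        q≤Et i = trans (x∧y≤y _ _) (trans (Q-strict t̄) (E*-lower t̄ i))
        q≤E = ≤-E*-extend s̄ b̄ (λ l → q≤Et (lookup S l)) (x∧y≤x _ _)
        t≡x : ∀ i → t̄ i ≡ b̄′ (x i)
        t≡x i with x-cases i
        ... | inj₁ (j , t≡ , x≡) = ≡.trans (≡.cong (λ t → evalᵗ M t ā) t≡)
          (≡.trans (≡.sym (old≡ s̄ j)) (≡.sym (≡.cong b̄′ x≡)))
        ... | inj₂ (l , ≡.refl , x≡) =
          ≡.trans (≡.sym (extend-↑ˡ s̄ b̄ l)) (≡.sym (≡.cong b̄′ x≡))
        t≐x : ∀ i → E* b̄ ∧ Q t̄ ≤ [ t̄ i ≐ b̄′ (x i) ]
        t≐x i = ≐-reflexive (t≡x i) (q≤Et i)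

  open StepSemantics using (close-≈)

  -- Unnesting by recursion on terms, and atomic formulae.

  ≐-funᴹ-strict : ∀ {m} (f : Fun m) {a} c̄ → [ a ≐ funᴹ f c̄ ] ≤ E* c̄
  ≐-funᴹ-strict f c̄ = trans ≐-strictʳ (reflexive (funᴹ-E f c̄))

  ≐-funᴹ-resp : ∀ {m q} (f : Fun m) {a b} c̄ d̄ → q ≤ [ a ≐ b ] → q ≤ [ c̄ ≐* d̄ ] →
                q ≤ [ a ≐ funᴹ f c̄ ] → q ≤ [ b ≐ funᴹ f d̄ ]
  ≐-funᴹ-resp f c̄ d̄ a≐b c̄≐d̄ h =
    ≐-trans (trans a≐b ≐-sym) (≐-trans h (trans c̄≐d̄ (funᴹ-resp f c̄ d̄)))

  -- The formula is evaluated at `b̄` but `t` at `ā`, which is read off from `b̄` along `ρ`.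
  -- Prefixing new variables changes only `b̄` and `ρ`, so the induction hypothesis fits the
  -- conjuncts as they stand.
  unnestVar-≈ : ∀ {n k} (ρ : Fin n → Fin k) j (t : Term L n) ā b̄ → (∀ i → b̄ (ρ i) ≡ ā i) →
                evalᶠ M (unnestVar ρ j t) b̄ ≈ E* b̄ ∧ [ b̄ j ≐ evalᵗ M t ā ]
  unnestVar-≈ ρ j (var i) ā b̄ b̄ρ≡ā =
    subst (λ a → _ ≈ E* b̄ ∧ [ b̄ j ≐ a ]) (b̄ρ≡ā i) (evalᵃ-≈ (var j ≐ var (ρ i)) b̄)
  -- The constant is restricted to `E* b̄` on one side and to `E* ā` on the other. The equation
  -- forces the extent of the constant, and below it and `E* b̄` both restrictions agree, because
  -- every entry of `ā` occurs in `b̄`.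
  unnestVar-≈ ρ j (const c) ā b̄ b̄ρ≡ā = Eq.trans (evalᵃ-≈ (var j ≐ const c) b̄) (antisym
    (∧-greatest (x∧y≤x _ _) (≐-trans (x∧y≤y _ _)
      (↾-≐-↾ (trans (x∧y≤y _ _) (trans ≐-strictʳ (E-↾-≤ˡ _ _))) (x∧y≤x _ _) q≤Eā)))
    (∧-greatest (x∧y≤x _ _) (≐-trans (x∧y≤y _ _)
      (↾-≐-↾ (trans (x∧y≤y _ _) (trans ≐-strictʳ (E-↾-≤ˡ _ _))) q≤Eā (x∧y≤x _ _)))))
    where
    q≤Eā : ∀ {r} → E* b̄ ∧ r ≤ E* ā
    q≤Eā = E*-greatest ā λ i → trans (x∧y≤x _ _)
      (subst (λ a → E* b̄ ≤ E a) (b̄ρ≡ā i) (E*-lower b̄ (ρ i)))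
  unnestVar-≈ ρ j (fun f ts) ā b̄ b̄ρ≡ā =
    close-≈ ρ ts _ _ ā b̄ b̄ρ≡ā (λ c̄ → [ b̄ j ≐ funᴹ f c̄ ])
      (≐-funᴹ-strict f)
      -- The left side `b̄ j` does not vary with `c̄`; its self-equality comes from strictness of
      -- the equation.
      (λ c̄ d̄ → ≐-funᴹ-resp f c̄ d̄ (≐-refl (trans (x∧y≤y _ _) ≐-strictˡ)) (x∧y≤x _ _) (x∧y≤y _ _))
      (λ i b̄′ → unnestVar-≈ old (x i) (ts i) ā b̄′)
      (λ b̄′ h → subst (λ a → _ ≈ E* b̄′ ∧ [ a ≐ funᴹ f (b̄′ ∘ x) ]) (h j)
                      (evalᵃ-≈ (var (s ↑ʳ j) ≐ fun f (var ∘ x)) b̄′))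
    where open Step ρ ts

  ∃-const-≈ : ∀ {n} (c d : Const) (ā : Vector Section n) →
    evalᶠ M ((const c ≐ const d) ^∃) ā ≈ E* ā ∧ ⟦ const c ≐ const d ⟧ᵃ ā
  ∃-const-≈ c d ā = Eq.trans (evalᶠ-∃ ψ ā) (antisym
    (⋁-least _ _ λ s → trans (reflexive (ψ-≈ s))
      (∧-greatest (trans (x∧y≤x _ _) (trans (x∧y≤x _ _) (x∧y≤y _ _)))
        (≐-trans (trans (x∧y≤x _ _) (trans (x∧y≤y _ _) ≐-sym))
                 (trans (x∧y≤y _ _) (x∧y≤y _ _)))))
    (trans (∧-greatest (∧-greatest q≤E (≐-refl q≤Ec)) (∧-greatest q≤E (x∧y≤y _ _)))
    -- The join is attained at the value of `c`.
    (trans (reflexive (Eq.sym (ψ-≈ (constᴹ c ↾ E* ā))))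
           (⋁-upper (λ s → evalᶠ M ψ (s Vector.∷ ā)) (constᴹ c ↾ E* ā)))))
    where
    ψ₁ ψ₂ ψ : Formula L _
    ψ₁ = atom (var zero ≐ const c)
    ψ₂ = atom (var zero ≐ const d)
    ψ = ψ₁ ∧′ ψ₂
    ψ-≈ : ∀ s → let b̄ = s Vector.∷ ā in
      evalᶠ M ψ b̄ ≈ (E* b̄ ∧ [ s ≐ constᴹ c ↾ E* ā ]) ∧ (E* b̄ ∧ [ s ≐ constᴹ d ↾ E* ā ])
    -- Reading both equations as unnestings along `suc` evaluates the constants at `ā`,
    -- independently of `s`.
    ψ-≈ s = Eq.trans (evalᶠ-∧ ψ₁ ψ₂ (s Vector.∷ ā))
      (∧-cong (unnestVar-≈ suc zero (const c) ā (s Vector.∷ ā) λ _ → ≡.refl)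
              (unnestVar-≈ suc zero (const d) ā (s Vector.∷ ā) λ _ → ≡.refl))
    q≤Ec = trans (x∧y≤y _ _) ≐-strictˡ
    q≤E = ∧-greatest q≤Ec (x∧y≤x _ _)

  -- The right side is also the value of `φ`, by `evalᵃ-≈`. All recursion lies in `unnestVar-≈`;
  -- each direct use of `close-≈` here is a single step along `id`.
  unnest-≈ : ∀ {n} (φ : Atomic L n) ā → evalᶠ M (φ ^∃) ā ≈ E* ā ∧ ⟦ φ ⟧ᵃ ā
  unnest-≈ (var i ≐ t)              ā = unnestVar-≈ id i t ā ā λ _ → ≡.refl
  unnest-≈ φ@(const c ≐ var j)      ā = evalᵃ-≈ φ ā
  unnest-≈ (const c ≐ const d)      ā = ∃-const-≈ c d ā
  unnest-≈ (const c ≐ fun f ts)     ā =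
    -- `c̄ zero` stands for the term opposite `f`, so strictness and compatibility of `Q` must now
    -- cover both sides of the equation.
    close-≈ id us _ _ ā ā (λ _ → ≡.refl) (λ c̄ → [ c̄ zero ≐ funᴹ f (c̄ ∘ suc) ])
      (λ c̄ → ∧-greatest ≐-strictˡ (≐-funᴹ-strict f (c̄ ∘ suc)))
      (λ c̄ d̄ → ≐-funᴹ-resp f (c̄ ∘ suc) (d̄ ∘ suc) (trans (x∧y≤x _ _) (x∧y≤x _ _))
                 (trans (x∧y≤x _ _) (x∧y≤y _ _)) (x∧y≤y _ _))
      (λ i b̄′ → unnestVar-≈ old (x i) (us i) ā b̄′)
      (λ b̄′ _ → evalᵃ-≈ (var (x zero) ≐ fun f (var ∘ x ∘ suc)) b̄′)
    where us = const c Vector.∷ ts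
          open Step id us
  unnest-≈ (fun f ts ≐ t)           ā =
    close-≈ id us _ _ ā ā (λ _ → ≡.refl) (λ c̄ → [ funᴹ f (c̄ ∘ suc) ≐ c̄ zero ])
      (λ c̄ → ∧-greatest ≐-strictʳ (trans ≐-sym (≐-funᴹ-strict f (c̄ ∘ suc))))
      -- Symmetry before and after reduces the reversed equation to the orientation of
      -- `≐-funᴹ-resp`.
      (λ c̄ d̄ → trans (≐-funᴹ-resp f (c̄ ∘ suc) (d̄ ∘ suc) (trans (x∧y≤x _ _) (x∧y≤x _ _))
                 (trans (x∧y≤x _ _) (x∧y≤y _ _)) (trans (x∧y≤y _ _) ≐-sym)) ≐-sym)
      (λ i b̄′ → unnestVar-≈ old (x i) (us i) ā b̄′)
      (λ b̄′ _ → evalᵃ-≈ (fun f (var ∘ x ∘ suc) ≐ var (x zero)) b̄′)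
    where us = t Vector.∷ ts
          open Step id us
  unnest-≈ (rel R ts)               ā =
    close-≈ id ts _ _ ā ā (λ _ → ≡.refl) (relᴹ R) (relᴹ-≤E R) (relᴹ-resp R)
      (λ i b̄′ → unnestVar-≈ old (x i) (ts i) ā b̄′)
      (λ b̄′ _ → evalᵃ-≈ (rel R (var ∘ x)) b̄′)
    where open Step id ts

theorem7p6 : {ℓ : Level} (Ω : CompleteHeytingAlgebra ℓ) (L : Signature Ω) {n : ℕ} (φ : Atomic L n)
    (M : Structure L) (ā : Vector (Structure.Section M) n) →
    CompleteHeytingAlgebra._≈_ Ω (⟦ atom φ ⟧[ M ] ā) (⟦ φ ^∃ ⟧[ M ] ā)
theorem7p6 Ω L φ M ā = Eq.trans (evalᵃ-≈ φ ā) (Eq.sym (unnest-≈ φ ā))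
  where open CompleteHeytingAlgebra Ω using (module Eq)
        open Semantics M
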